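{- Let $q \equiv 3 \pmod{4}$ be a prime power. Then $$\mathcal{K}_4(G_2(q)) = \frac{q(q-1)(q-3)(q-7)}{2^6}.$$
   Context: $G_2(q)$ is the Paley tournament of order $q$: the digraph with vertex set the finite field $\mathbb{F}_q$ where $a \to b$ is an edge if and only if $b-a$ is a nonzero square in $\mathbb{F}_q$. For a digraph $G$, $\mathcal{K}_m(G)$ is the number of transitive subtournaments of order $m$ contained in $G$; a tournament of order $m$ is transitive if its vertices can be listed $a_1,\dots,a_m$ with $a_i \to a_j$ for all $i<j$. -}

module Defs where

open import Algebra.Bundles using (CommutativeRing)
open import Data.Bool.Base using (true; false)
open import Data.Fin.Base as Fin using (Fin; zero; suc)
import Data.Fin.Properties as Fin
open import Data.Fin.Subset using (Subset; _∈_; ∣_∣)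
open import Data.Fin.Subset.Properties using (_∈?_)
open import Data.List.Base as List using (List; cartesianProductWith; filter; length)
open import Data.Nat.Base using (ℕ; zero; suc; _≤_; _^_)
import Data.Nat.Properties as ℕ
open import Data.Nat.Primality using (Prime)
open import Data.Product.Base using (∃; ∃₂; _×_; _,_)
open import Data.Sum.Base using (_⊎_)
open import Data.Vec.Base using (Vec; []; _∷_; lookup)
open import Function.Base using (_∘_)
open import Function.Bundles using (Inverse; _⇔_; mk⇔; Equivalence)
open import Level using (Level; _⊔_)
open import Relation.Binary.Core using (Rel)
open import Relation.Binary.Definitions using (Decidable)
open import Relation.Binary.PropositionalEquality as ≡ using (_≡_; _≢_)
open import Relation.Nullary using (¬_; Dec)
open import Relation.Nullary.Decidable as Dec
  using (_×-dec_; _⊎-dec_; _→-dec_; ¬?)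
import Relation.Unary as U

private variable
  a c ℓ p : Level
  m n q : ℕ

IsPrimePower : ℕ → Set
IsPrimePower q = ∃₂ λ p k → Prime p × 1 ≤ k × q ≡ p ^ k

------------------------------------------------------------------------
-- Finite fields

record FiniteField (c ℓ : Level) (q : ℕ) : Set (Level.suc (c ⊔ ℓ)) where
  field
    commutativeRing : CommutativeRing c ℓ
  open CommutativeRing commutativeRing public
  field
    0≉1         : ¬ 0# ≈ 1#
    inverse     : ∀ x → ¬ x ≈ 0# → ∃ λ y → x * y ≈ 1#
    enumeration : Inverse (≡.setoid (Fin q)) setoid

  element : Fin q → Carrier
  element = Inverse.to enumeration

  index : Carrier → Fin q
  index = Inverse.from enumeration

  IsNonzeroSquare : Carrier → Set (c ⊔ ℓ)
  IsNonzeroSquare x = ¬ x ≈ 0# × ∃ λ y → y * y ≈ x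

  element-index : ∀ x → element (index x) ≈ x
  element-index x = Inverse.inverseˡ enumeration ≡.refl

  infix 4 _≈?_
  _≈?_ : Decidable _≈_
  x ≈? y = Dec.map′
    (λ eq → trans (sym (element-index x))
              (trans (Inverse.to-cong enumeration eq) (element-index y)))
    (Inverse.from-cong enumeration)
    (index x Fin.≟ index y)

  isNonzeroSquare? : U.Decidable IsNonzeroSquare
  isNonzeroSquare? x = ¬? (x ≈? 0#) ×-dec Dec.map′
    (λ (i , eq) → element i , eq)
    (λ (y , eq) → index y
       , trans (*-cong (element-index y) (element-index y)) eq)
    (Fin.any? λ i → element i * element i ≈? x)

------------------------------------------------------------------------
-- Digraphs and the number of transitive subtournaments

record Digraph (ℓ : Level) (n : ℕ) : Set (Level.suc ℓ) where
  field
    Edge  : Rel (Fin n) ℓ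
    edge? : Decidable Edge

-- A set of vertices together with a set of arcs; row u of `arcs` is the set
-- of out-neighbours of u.  This first-order encoding makes subdigraphs equal
-- exactly when they have the same vertices and the same arcs.
record Subdigraph (n : ℕ) : Set where
  constructor subdigraph
  field
    vertices : Subset n
    arcs     : Vec (Subset n) n

  Arc : Rel (Fin n) _
  Arc u v = v ∈ lookup arcs u

  arc? : Decidable Arc
  arc? u v = v ∈? lookup arcs u

open Subdigraph

_ContainedIn_ : Subdigraph n → Digraph ℓ n → Set ℓ
H ContainedIn G = ∀ u v → Arc H u v →
  u ∈ vertices H × v ∈ vertices H × Digraph.Edge G u v

IsTournament : Subdigraph n → Set
IsTournament H =
  (∀ u → ¬ Arc H u u) ×
  (∀ u v → u ∈ vertices H → v ∈ vertices H → u ≢ v →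
     (Arc H u v × ¬ Arc H v u) ⊎ (¬ Arc H u v × Arc H v u))

-- Used only for H with exactly m vertices, where a list of length m that
-- covers all vertices has no repetitions.
IsTransitiveListing : Subdigraph n → Vec (Fin n) m → Set
IsTransitiveListing {m = m} H as =
  (∀ v → v ∈ vertices H ⇔ ∃ λ i → lookup as i ≡ v) ×
  (∀ (i j : Fin m) → i Fin.< j → Arc H (lookup as i) (lookup as j))

IsTransitiveSubtournament : Digraph ℓ n → ℕ → Subdigraph n → Set ℓ
IsTransitiveSubtournament {n = n} G m H =
  H ContainedIn G ×
  IsTournament H ×
  ∣ vertices H ∣ ≡ m ×
  ∃ λ (as : Vec (Fin n) m) → IsTransitiveListing H as

_containedIn?_ : (H : Subdigraph n) (G : Digraph ℓ n) → Dec (H ContainedIn G)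
H containedIn? G = Fin.all? λ u → Fin.all? λ v → arc? H u v →-dec
  (u ∈? vertices H ×-dec v ∈? vertices H ×-dec Digraph.edge? G u v)

isTournament? : (H : Subdigraph n) → Dec (IsTournament H)
isTournament? H =
  Fin.all? (λ u → ¬? (arc? H u u)) ×-dec
  Fin.all? λ u → Fin.all? λ v →
    u ∈? vertices H →-dec v ∈? vertices H →-dec ¬? (u Fin.≟ v) →-dec
    ((arc? H u v ×-dec ¬? (arc? H v u)) ⊎-dec (¬? (arc? H u v) ×-dec arc? H v u))

isTransitiveListing? : (H : Subdigraph n) (as : Vec (Fin n) m) →
                       Dec (IsTransitiveListing H as)
isTransitiveListing? H as =
  Fin.all? (λ v → ⇔-dec (v ∈? vertices H) (Fin.any? λ i → lookup as i Fin.≟ v))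
  ×-dec
  Fin.all? λ i → Fin.all? λ j →
    i Fin.<? j →-dec arc? H (lookup as i) (lookup as j)
  where
  ⇔-dec : ∀ {A B : Set} → Dec A → Dec B → Dec (A ⇔ B)
  ⇔-dec a? b? = Dec.map′ (λ (f , g) → mk⇔ f g)
    (λ e → Equivalence.to e , Equivalence.from e)
    ((a? →-dec b?) ×-dec (b? →-dec a?))

anyVec? : ∀ m {P : Vec (Fin n) m → Set p} → U.Decidable P → Dec (∃ P)
anyVec? zero    P? = Dec.map′ ([] ,_) (λ { ([] , p) → p }) (P? [])
anyVec? (suc m) P? = Dec.map′
  (λ (x , xs , p) → x ∷ xs , p)
  (λ { (x ∷ xs , p) → x , xs , p })
  (Fin.any? λ x → anyVec? m (P? ∘ (x ∷_)))

isTransitiveSubtournament? : (G : Digraph ℓ n) (m : ℕ) →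
                             U.Decidable (IsTransitiveSubtournament G m)
isTransitiveSubtournament? G m H =
  H containedIn? G ×-dec
  isTournament? H ×-dec
  ∣ vertices H ∣ ℕ.≟ m ×-dec
  anyVec? m (isTransitiveListing? H)

allVecs : {A : Set a} → List A → ∀ n → List (Vec A n)
allVecs xs zero    = List.[ [] ]
allVecs xs (suc n) = cartesianProductWith _∷_ xs (allVecs xs n)

allSubsets : ∀ n → List (Subset n)
allSubsets = allVecs (false List.∷ true List.∷ List.[])

-- Lists every value of `Subdigraph n` exactly once.
allSubdigraphs : ∀ n → List (Subdigraph n)
allSubdigraphs n =
  cartesianProductWith subdigraph (allSubsets n) (allVecs (allSubsets n) n)

𝒦 : ℕ → Digraph ℓ n → ℕ
𝒦 {n = n} m G =
  length (filter (isTransitiveSubtournament? G m) (allSubdigraphs n))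

------------------------------------------------------------------------
-- The Paley tournament; vertex i stands for the field element `element i`.

G₂ : FiniteField c ℓ q → Digraph (c ⊔ ℓ) q
G₂ F = record
  { Edge  = λ a b → IsNonzeroSquare (element b - element a)
  ; edge? = λ a b → isNonzeroSquare? (element b - element a)
  } where open FiniteField F

module Submission where

-- Listing the vertices of a transitive tournament in order identifies it
-- with its listing, so 𝒦 4 counts the vectors (a, b, c, d) whose entries are
-- joined by arcs from earlier to later ones (𝒦≡chains).  These vectors arise
-- by choosing an arc a → b and then an arc c → d among the common successors
-- of a and b.
--
-- Two facts make this count exact.  First, in any tournament a set of N
-- vertices spans (N² - N) / 2 arcs (chains₂-tournament).  Second, every arc of
-- the Paley tournament has the same number M of common successors
-- (common-successors): translating by a and dividing by the nonzero square
-- b - a turns the common successors of a and b into the nonzero squares x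
-- with x - 1 a nonzero square.
--
-- Write q = 4j + 3 and let S be the number of nonzero squares.  Squaring is
-- two-to-one on nonzero elements, so q = 2S + 1 and S = 2j + 1 is odd.  Were -1
-- a square, negation would pair off the nonzero squares and S would be even;
-- hence -1 is not a square, exactly one of x and -x is a square for every
-- x ≠ 0 (trichotomy), and the digraph is a tournament.  The arcs between
-- nonzero squares number S·M by the second fact and (S² - S) / 2 by the first,
-- so M = j.  There are q·S arcs a → b, each with (M² - M) / 2 arcs among its
-- common successors, whence 2·𝒦 4 = q·(2j + 1)·(j² - j), which is the asserted
-- value for q = 4j + 3.

open import Defs
import Algebra.Properties.Semiring.Sum as Sum
open import Data.Bool.Base using (true; false; if_then_else_; _∧_)
open import Data.Fin.Base as Fin using (Fin; zero; suc)
open import Data.Fin.Permutation using (permutation)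
import Data.Fin.Properties as Fin
open import Data.Fin.Subset using (Subset; _∈_; ∣_∣)
open import Data.Fin.Subset.Properties using (⊆-antisym)
import Data.Integer.Base as ℤ
import Data.Integer.Properties as ℤ
import Data.Integer.Tactic.RingSolver as ℤ
open import Data.List.Base as List
  using (List; []; _∷_; _++_; filter; length; cartesianProductWith; allFin)
open import Data.List.Membership.Propositional using () renaming (_∈_ to _∈ₗ_)
open import Data.List.Membership.Propositional.Properties
  using (∈-cartesianProductWith⁺; ∈-filter⁺; ∈-filter⁻; ∈-map⁺; ∈-map⁻; ∈-allFin)
open import Data.List.Membership.Propositional.Properties.WithK using (unique∧set⇒bag)
import Data.List.Properties as List
open import Data.List.Relation.Binary.BagAndSetEquality using (∼bag⇒↭)
open import Data.List.Relation.Binary.Permutation.Propositional.Properties using (↭-length)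
import Data.List.Relation.Unary.All as ListAll
import Data.List.Relation.Unary.All.Properties as ListAll
open import Data.List.Relation.Unary.AllPairs using ([]; _∷_)
open import Data.List.Relation.Unary.Any using (here; there)
open import Data.List.Relation.Unary.Unique.Propositional using (Unique)
import Data.List.Relation.Unary.Unique.Propositional.Properties as Unique
open import Data.Nat.Base as ℕ using (ℕ; zero; suc; _≤_; z≤n; s≤s; z<s; s<s; s<s⁻¹; _%_; _^_)
open import Data.Nat.DivMod using (m≡m%n+[m/n]*n)
open import Data.Nat.ListAction using (sum)
open import Data.Nat.ListAction.Properties using (sum-++)
import Data.Nat.Properties as ℕ
open import Data.Nat.Tactic.RingSolver using (solve-∀)
open import Data.Product.Base using (∃; ∃₂; _×_; _,_; proj₁; proj₂)
open import Data.Rational.Base using (_/_)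
open import Data.Rational.Properties using (fromℚᵘ-cong)
open import Data.Rational.Unnormalised.Base using (mkℚᵘ; *≡*)
open import Data.Sum.Base using (_⊎_; inj₁; inj₂; [_,_])
open import Data.Vec.Base as Vec using (Vec; []; _∷_; lookup)
import Data.Vec.Properties as Vec
open import Data.Vec.Relation.Unary.All as All using (All; []; _∷_)
import Data.Vec.Relation.Unary.All.Properties as All
open import Data.Vec.Relation.Unary.AllPairs using (AllPairs; []; _∷_; allPairs?)
open import Function.Base using (_∘_; id)
open import Function.Bundles using (Inverse; mk⇔; Equivalence)
open import Level using (Level)
open import Relation.Binary.Core using (Rel)
open import Relation.Binary.Definitions using (Decidable; Asymmetric; tri<; tri≈; tri>)
open import Relation.Binary.PropositionalEquality
  using (_≡_; _≢_; refl; sym; trans; cong; cong₂; subst; subst₂; _≗_; module ≡-Reasoning)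
import Relation.Binary.Reasoning.Setoid as SetoidReasoning
open import Relation.Nullary using (¬_; Dec; yes; no; does; contradiction)
open import Relation.Nullary.Decidable as Dec using (_×-dec_)
import Relation.Unary as U

open Sum ℕ.+-*-semiring
  using (sum-syntax; sum-cong-≗; sum-replicate-zero; ∑-distrib-+; ∑-comm; ∑-permute;
         *-distribˡ-sum; *-distribʳ-sum)

private variable
  a ℓ p : Level
  A B C P Q : Set a
  m n : ℕ

-- Indicators and finite sums

module FiniteSums where

  open import Data.Nat.Base using (_+_; _*_)

  -- The indicator of a decided proposition, as a natural number, so that
  -- cardinalities of decidable sets become finite sums.
  χ : Dec P → ℕ
  χ d = if does d then 1 else 0

  χ-yes : (d : Dec P) → P → χ d ≡ 1
  χ-yes (yes _) p = refl
  χ-yes (no ¬p) p = contradiction p ¬p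

  χ-no : (d : Dec P) → ¬ P → χ d ≡ 0
  χ-no (yes p) ¬p = contradiction p ¬p
  χ-no (no _)  ¬p = refl

  χ-cong : (d : Dec P) (e : Dec Q) → (P → Q) → (Q → P) → χ d ≡ χ e
  χ-cong d (yes q) f g = χ-yes d (g q)
  χ-cong d (no ¬q) f g = χ-no d (¬q ∘ f)

  χ-≤1 : (d : Dec P) → χ d ≤ 1
  χ-≤1 (yes _) = s≤s z≤n
  χ-≤1 (no _)  = z≤n

  χ-idem : (d : Dec P) → χ d * χ d ≡ χ d
  χ-idem (yes _) = refl
  χ-idem (no _)  = refl

  χ-∧ : ∀ x y → (if x ∧ y then 1 else 0) ≡
                (if x then 1 else 0) * (if y then 1 else 0)
  χ-∧ true  y = sym (ℕ.+-identityʳ _)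
  χ-∧ false y = refl

  χ-× : (d : Dec P) (e : Dec Q) → χ (d ×-dec e) ≡ χ d * χ e
  χ-× d e = χ-∧ (does d) (does e)

  ∑-zero : {f : Fin n → ℕ} → (∀ i → f i ≡ 0) → ∑[ i < n ] f i ≡ 0
  ∑-zero {n} f≡0 = trans (sum-cong-≗ f≡0) (sum-replicate-zero n)

  ∑-const : ∀ n k → ∑[ i < n ] k ≡ n * k
  ∑-const zero    k = refl
  ∑-const (suc n) k = cong (k +_) (∑-const n k)

  ∑-one : ∀ n → ∑[ i < n ] 1 ≡ n
  ∑-one n = trans (∑-const n 1) (ℕ.*-identityʳ n)

  ∑-δ : (f : Fin n → ℕ) (i : Fin n) → ∑[ j < n ] (f j * χ (i Fin.≟ j)) ≡ f i
  ∑-δ {suc n} f zero = trans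
    (cong₂ _+_ (ℕ.*-identityʳ (f zero)) (∑-zero (λ j → ℕ.*-zeroʳ (f (suc j)))))
    (ℕ.+-identityʳ (f zero))
  ∑-δ {suc n} f (suc i) = cong₂ _+_ (ℕ.*-zeroʳ (f zero)) (∑-δ (f ∘ suc) i)

  ∑-mono : {f g : Fin n → ℕ} → (∀ i → f i ≤ g i) → ∑[ i < n ] f i ≤ ∑[ i < n ] g i
  ∑-mono {zero}  f≤g = z≤n
  ∑-mono {suc n} f≤g = ℕ.+-mono-≤ (f≤g zero) (∑-mono (f≤g ∘ suc))

  -- A sum of n terms, each at most 1, reaches n only if every term is 1.
  ∑-≤1-tight : {f : Fin n → ℕ} → (∀ i → f i ≤ 1) → ∑[ i < n ] f i ≡ n → ∀ i → f i ≡ 1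
  ∑-≤1-tight {suc n} {f} f≤1 eq = λ where
      zero    → f₀≡1
      (suc i) → ∑-≤1-tight (f≤1 ∘ suc)
        (ℕ.suc-injective (trans (cong (_+ ∑[ j < n ] f (suc j)) (sym f₀≡1)) eq)) i
    where
    rest≤n : ∑[ i < n ] f (suc i) ≤ n
    rest≤n = ℕ.≤-trans (∑-mono (f≤1 ∘ suc))
      (ℕ.≤-reflexive (∑-one n))
    f₀≡1 : f zero ≡ 1
    f₀≡1 = ℕ.≤-antisym (f≤1 zero)
      (ℕ.+-cancelʳ-≤ n 1 (f zero)
        (ℕ.≤-trans (ℕ.≤-reflexive (sym eq)) (ℕ.+-monoʳ-≤ (f zero) rest≤n)))

  -- The sum over all pairs of indices.
  ∑∑ : (Fin m → Fin n → ℕ) → ℕ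
  ∑∑ {m} {n} f = ∑[ u < m ] ∑[ v < n ] f u v

  ∑∑-+ : (f g : Fin m → Fin n → ℕ) → ∑∑ (λ u v → f u v + g u v) ≡ ∑∑ f + ∑∑ g
  ∑∑-+ {m} {n} f g = trans (sum-cong-≗ λ u → ∑-distrib-+ (f u) (g u))
    (∑-distrib-+ (λ u → ∑[ v < n ] f u v) (λ u → ∑[ v < n ] g u v))

  k+k≢1+2j : ∀ k j → k + k ≢ suc (2 * j)
  k+k≢1+2j k j eq = ℕ.even≢odd k j (trans (cong (k +_) (ℕ.+-identityʳ k)) eq)

  -- A weight invariant under an involution, and vanishing at its fixed points,
  -- has an even sum.
  ∑-involution : (σ : Fin n → Fin n) → (∀ i → σ (σ i) ≡ i) →
    (w : Fin n → ℕ) → (∀ i → w (σ i) ≡ w i) → (∀ i → w i ≡ 0 ⊎ σ i ≢ i) →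
    ∃ λ k → ∑[ i < n ] w i ≡ k + k
  ∑-involution {n} σ σσ w wσ fp = k , (begin
    ∑[ i < n ] w i                            ≡⟨ sum-cong-≗ split ⟩
    ∑[ i < n ] (up i + up (σ i))              ≡⟨ ∑-distrib-+ up (up ∘ σ) ⟩
    k + ∑[ i < n ] up (σ i)                   ≡⟨ cong (k +_) (∑-permute up (permutation σ σ σσ σσ)) ⟨
    k + k                                     ∎)
    where
    open ≡-Reasoning
    -- The weight carried by the smaller element of each two-element orbit.
    up : Fin n → ℕ
    up i = w i * χ (i Fin.<? σ i)
    k = ∑[ i < n ] up i
    left : ∀ x → x ≡ x * 1 + x * 0
    left = solve-∀
    right : ∀ x → x ≡ x * 0 + x * 1
    right = solve-∀
    split : ∀ i → w i ≡ up i + up (σ i)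
    split i rewrite σσ i | wσ i with fp i
    ... | inj₁ w≡0 rewrite w≡0 = refl
    ... | inj₂ σi≢i with Fin.<-cmp i (σ i)
    ...   | tri< i<σi _ σi≮i rewrite χ-yes (i Fin.<? σ i) i<σi | χ-no (σ i Fin.<? i) σi≮i =
            left (w i)
    ...   | tri≈ _ i≡σi _ = contradiction (sym i≡σi) σi≢i
    ...   | tri> i≮σi _ σi<i rewrite χ-no (i Fin.<? σ i) i≮σi | χ-yes (σ i Fin.<? i) σi<i =
            right (w i)

  -- The sum of f over the entries of a list, with multiplicity.
  ∑ˡ : List A → (A → ℕ) → ℕ
  ∑ˡ xs f = sum (List.map f xs)

  ∑ˡ-cong : (xs : List A) {f g : A → ℕ} → f ≗ g → ∑ˡ xs f ≡ ∑ˡ xs g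
  ∑ˡ-cong xs f≗g = cong sum (List.map-cong f≗g xs)

  length-filter≡∑ˡ : {P : A → Set p} (P? : U.Decidable P) (xs : List A) →
                     length (filter P? xs) ≡ ∑ˡ xs (χ ∘ P?)
  length-filter≡∑ˡ P? []       = refl
  length-filter≡∑ˡ P? (x ∷ xs) with does (P? x)
  ... | true  = cong suc (length-filter≡∑ˡ P? xs)
  ... | false = length-filter≡∑ˡ P? xs

  ∑ˡ-cartesianProductWith : (f : A → B → C) (xs : List A) (ys : List B) (h : C → ℕ) →
    ∑ˡ (cartesianProductWith f xs ys) h ≡ ∑ˡ xs (λ x → ∑ˡ ys (λ y → h (f x y)))
  ∑ˡ-cartesianProductWith f []       ys h = refl
  ∑ˡ-cartesianProductWith f (x ∷ xs) ys h = begin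
    sum (List.map h (List.map (f x) ys ++ cartesianProductWith f xs ys))
      ≡⟨ cong sum (List.map-++ h (List.map (f x) ys) _) ⟩
    sum (List.map h (List.map (f x) ys) ++ List.map h (cartesianProductWith f xs ys))
      ≡⟨ sum-++ (List.map h (List.map (f x) ys)) _ ⟩
    ∑ˡ (List.map (f x) ys) h + ∑ˡ (cartesianProductWith f xs ys) h
      ≡⟨ cong₂ _+_ (cong sum (sym (List.map-∘ ys))) (∑ˡ-cartesianProductWith f xs ys h) ⟩
    ∑ˡ ys (h ∘ f x) + ∑ˡ xs (λ x → ∑ˡ ys (λ y → h (f x y))) ∎
    where open ≡-Reasoning

  ∑ˡ-allFin : (f : Fin n → ℕ) → ∑ˡ (allFin n) f ≡ ∑[ i < n ] f i
  ∑ˡ-allFin f = trans (cong sum (List.map-tabulate id f)) (sum-tabulate f)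
    where
    sum-tabulate : ∀ {n} (f : Fin n → ℕ) → sum (List.tabulate f) ≡ ∑[ i < n ] f i
    sum-tabulate {zero}  f = refl
    sum-tabulate {suc n} f = cong (f zero +_) (sum-tabulate (f ∘ suc))

open FiniteSums

-- Chains in a digraph

module Chains where

  open import Data.Nat.Base using (_+_; _*_)

  -- For e the indicator of a relation and w the indicator of a set of vertices,
  -- chains e m w counts the vectors of m vertices of the set in which e relates
  -- every entry to all later ones: u is the first entry, and the remaining ones
  -- are chosen among the successors of u.
  chains : (Fin n → Fin n → ℕ) → ℕ → (Fin n → ℕ) → ℕ
  chains     e zero    w = 1
  chains {n} e (suc m) w = ∑[ u < n ] (w u * chains e m (λ v → w v * e u v))

  chains-cong : (e : Fin n → Fin n → ℕ) (m : ℕ) {w w′ : Fin n → ℕ} → w ≗ w′ →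
                chains e m w ≡ chains e m w′
  chains-cong e zero    w≗w′ = refl
  chains-cong e (suc m) w≗w′ = sum-cong-≗ λ u →
    cong₂ _*_ (w≗w′ u) (chains-cong e m (λ v → cong (_* e u v) (w≗w′ v)))

  -- The product of the weights of the entries of a vector.
  ∏ : (Fin n → ℕ) → Vec (Fin n) m → ℕ
  ∏ w []       = 1
  ∏ w (u ∷ us) = w u * ∏ w us

  ∏-one : (us : Vec (Fin n) m) → ∏ (λ _ → 1) us ≡ 1
  ∏-one []       = refl
  ∏-one (u ∷ us) = trans (ℕ.+-identityʳ _) (∏-one us)

  ∏-*-all : {P : Fin n → Set p} (P? : U.Decidable P) (w : Fin n → ℕ) (us : Vec (Fin n) m) →
    ∏ (λ v → w v * χ (P? v)) us ≡ ∏ w us * χ (All.all? P? us)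
  ∏-*-all P? w []       = refl
  ∏-*-all P? w (u ∷ us) = begin
    w u * χ (P? u) * ∏ (λ v → w v * χ (P? v)) us
      ≡⟨ cong (w u * χ (P? u) *_) (∏-*-all P? w us) ⟩
    w u * χ (P? u) * (∏ w us * χ (All.all? P? us))
      ≡⟨ interchange (w u) (χ (P? u)) (∏ w us) _ ⟩
    w u * ∏ w us * (χ (P? u) * χ (All.all? P? us))
      ≡⟨ cong (w u * ∏ w us *_) (χ-× (P? u) (All.all? P? us)) ⟨
    w u * ∏ w us * χ (All.all? P? (u ∷ us)) ∎
    where
    open ≡-Reasoning
    interchange : ∀ x y z t → x * y * (z * t) ≡ x * z * (y * t)
    interchange = solve-∀

  module _ {E : Rel (Fin n) ℓ} (E? : Decidable E) where

    private
      e : Fin n → Fin n → ℕ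
      e u v = χ (E? u v)

    -- The recursion defining chains agrees with direct enumeration of vectors.
    ∑ˡ-allPairs : ∀ m (w : Fin n → ℕ) →
      ∑ˡ (allVecs (allFin n) m) (λ us → ∏ w us * χ (allPairs? E? us)) ≡ chains e m w
    ∑ˡ-allPairs zero    w = refl
    ∑ˡ-allPairs (suc m) w = begin
      ∑ˡ (allVecs (allFin n) (suc m)) h
        ≡⟨ ∑ˡ-cartesianProductWith _∷_ (allFin n) vs h ⟩
      ∑ˡ (allFin n) (λ u → ∑ˡ vs (h ∘ (u ∷_)))
        ≡⟨ ∑ˡ-allFin {n} (λ u → ∑ˡ vs (h ∘ (u ∷_))) ⟩
      ∑[ u < n ] ∑ˡ vs (h ∘ (u ∷_))
        ≡⟨ sum-cong-≗ (λ u → trans (∑ˡ-cong vs (step u)) (*-∑ˡ (w u) vs)) ⟩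
      ∑[ u < n ] (w u * ∑ˡ vs (h′ u))
        ≡⟨ sum-cong-≗ (λ u → cong (w u *_) (∑ˡ-allPairs m (λ v → w v * e u v))) ⟩
      chains e (suc m) w ∎
      where
      open ≡-Reasoning
      vs = allVecs (allFin n) m
      h : ∀ {m} → Vec (Fin n) m → ℕ
      h us = ∏ w us * χ (allPairs? E? us)
      h′ : Fin n → Vec (Fin n) m → ℕ
      h′ u us = ∏ (λ v → w v * e u v) us * χ (allPairs? E? us)

      step : ∀ u us → h (u ∷ us) ≡ w u * h′ u us
      step u us = begin
        w u * ∏ w us * χ (allPairs? E? (u ∷ us))
          ≡⟨ cong (w u * ∏ w us *_) (χ-× (All.all? (E? u) us) (allPairs? E? us)) ⟩
        w u * ∏ w us * (χ (All.all? (E? u) us) * χ (allPairs? E? us))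
          ≡⟨ reassoc (w u) _ _ _ ⟩
        w u * (∏ w us * χ (All.all? (E? u) us) * χ (allPairs? E? us))
          ≡⟨ cong (λ x → w u * (x * χ (allPairs? E? us))) (∏-*-all (E? u) w us) ⟨
        w u * h′ u us ∎
        where
        reassoc : ∀ x y z t → x * y * (z * t) ≡ x * (y * z * t)
        reassoc = solve-∀

      *-∑ˡ : ∀ {A : Set} k (xs : List A) {f : A → ℕ} → ∑ˡ xs (λ x → k * f x) ≡ k * ∑ˡ xs f
      *-∑ˡ k []           = sym (ℕ.*-zeroʳ k)
      *-∑ˡ k (x ∷ xs) {f} = trans (cong (k * f x +_) (*-∑ˡ k xs))
        (sym (ℕ.*-distribˡ-+ k (f x) _))

    length-filter-allPairs : ∀ m →
      length (filter (allPairs? E?) (allVecs (allFin n) m)) ≡ chains e m (λ _ → 1)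
    length-filter-allPairs m = begin
      length (filter (allPairs? E?) vs)
        ≡⟨ length-filter≡∑ˡ (allPairs? E?) vs ⟩
      ∑ˡ vs (χ ∘ allPairs? E?)
        ≡⟨ ∑ˡ-cong vs (λ us → sym (trans (cong (_* χ (allPairs? E? us)) (∏-one us))
                                          (ℕ.+-identityʳ _))) ⟩
      ∑ˡ vs (λ us → ∏ (λ _ → 1) us * χ (allPairs? E? us))
        ≡⟨ ∑ˡ-allPairs m (λ _ → 1) ⟩
      chains e m (λ _ → 1) ∎
      where
      open ≡-Reasoning
      vs = allVecs (allFin n) m

  module _ (e : Fin n → Fin n → ℕ) (total : ∀ u v → e u v + e v u + χ (u Fin.≟ v) ≡ 1) where

    -- In a tournament a set of W vertices spans (W² - W) / 2 arcs: of its W²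
    -- ordered pairs (u, v), those with u = v number W, and for each other pair
    -- exactly one of u → v and v → u holds.
    chains₂-tournament : (w : Fin n → ℕ) → (∀ u → w u * w u ≡ w u) →
      chains e 2 w + chains e 2 w + ∑[ u < n ] w u ≡ (∑[ u < n ] w u) * (∑[ u < n ] w u)
    chains₂-tournament w idem = sym (begin
      W * W
        ≡⟨ *-distribʳ-sum W w ⟩
      ∑[ u < n ] (w u * W)
        ≡⟨ sum-cong-≗ (λ u → trans (*-distribˡ-sum (w u) w) (sum-cong-≗ (split u))) ⟩
      ∑∑ (λ u v → f u v + f v u + δ u v)
        ≡⟨ ∑∑-+ (λ u v → f u v + f v u) δ ⟩
      ∑∑ (λ u v → f u v + f v u) + ∑∑ δ
        ≡⟨ cong (_+ ∑∑ δ) (∑∑-+ f (λ u v → f v u)) ⟩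
      ∑∑ f + ∑∑ (λ u v → f v u) + ∑∑ δ
        ≡⟨ cong₂ _+_ (cong₂ _+_ ∑f (trans (∑-comm (λ u v → f v u)) ∑f)) (sum-cong-≗ ∑δ) ⟩
      chains e 2 w + chains e 2 w + W ∎)
      where
      open ≡-Reasoning
      W = ∑[ u < n ] w u
      f δ : Fin n → Fin n → ℕ
      f u v = w u * (w v * e u v)
      δ u v = w u * (w v * χ (u Fin.≟ v))

      split : ∀ u v → w u * w v ≡ f u v + f v u + δ u v
      split u v = begin
        w u * w v                                        ≡⟨ ℕ.*-identityʳ _ ⟨
        w u * w v * 1                                    ≡⟨ cong (w u * w v *_) (total u v) ⟨
        w u * w v * (e u v + e v u + χ (u Fin.≟ v))      ≡⟨ expand (w u) (w v) (e u v) (e v u) _ ⟩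
        f u v + f v u + δ u v                            ∎
        where
        expand : ∀ x y a b c → x * y * (a + b + c) ≡ x * (y * a) + y * (x * b) + x * (y * c)
        expand = solve-∀

      ∑f : ∑∑ f ≡ chains e 2 w
      ∑f = sum-cong-≗ λ u → trans (sym (*-distribˡ-sum (w u) (λ v → w v * e u v)))
        (cong (w u *_) (sum-cong-≗ λ v → sym (ℕ.*-identityʳ (w v * e u v))))

      ∑δ : ∀ u → ∑[ v < n ] δ u v ≡ w u
      ∑δ u = trans (sym (*-distribˡ-sum (w u) (λ v → w v * χ (u Fin.≟ v))))
        (trans (cong (w u *_) (∑-δ w u)) (idem u))

open Chains

-- Transitive subtournaments as listings

module Subtournaments where

  open import Data.Nat.Base using (_+_; _*_)

  allVecs-unique : {xs : List A} → Unique xs → ∀ n → Unique (allVecs xs n)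
  allVecs-unique xs! zero    = ListAll.[] ∷ []
  allVecs-unique xs! (suc n) =
    Unique.cartesianProductWith⁺ _∷_ Vec.∷-injective xs! (allVecs-unique xs! n)

  ∈-allVecs : {xs : List A} → (∀ x → x ∈ₗ xs) → (v : Vec A n) → v ∈ₗ allVecs xs n
  ∈-allVecs ∈xs []      = here refl
  ∈-allVecs ∈xs (x ∷ v) = ∈-cartesianProductWith⁺ _∷_ (∈xs x) (∈-allVecs ∈xs v)

  allSubsets-unique : ∀ n → Unique (allSubsets n)
  allSubsets-unique = allVecs-unique (((λ ()) ListAll.∷ ListAll.[]) ∷ (ListAll.[] ∷ []))

  ∈-allSubsets : (s : Subset n) → s ∈ₗ allSubsets n
  ∈-allSubsets = ∈-allVecs λ where
    false → here refl
    true  → there (here refl)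

  allSubdigraphs-unique : ∀ n → Unique (allSubdigraphs n)
  allSubdigraphs-unique n = Unique.cartesianProductWith⁺ subdigraph (λ { refl → refl , refl })
    (allSubsets-unique n) (allVecs-unique (allSubsets-unique n) n)

  ∈-allSubdigraphs : (H : Subdigraph n) → H ∈ₗ allSubdigraphs n
  ∈-allSubdigraphs (subdigraph vs as) =
    ∈-cartesianProductWith⁺ subdigraph (∈-allSubsets vs) (∈-allVecs ∈-allSubsets as)

  -- A map that is injective on the entries of a list, though perhaps not on the
  -- whole type, preserves absence of repetitions.
  map⁺-Unique : {P : A → Set p} (f : A → B) →
    (∀ {x y} → P x → P y → f x ≡ f y → x ≡ y) →
    {xs : List A} → ListAll.All P xs → Unique xs → Unique (List.map f xs)
  map⁺-Unique f inj ListAll.[]         []           = []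
  map⁺-Unique f inj (px ListAll.∷ pxs) (x∉xs ∷ xs!) =
    ListAll.map⁺ (ListAll.zipWith (λ (x≢y , py) → x≢y ∘ inj px py) (x∉xs , pxs))
    ∷ map⁺-Unique f inj pxs xs!

  module _ {P : Fin n → Set p} (P? : U.Decidable P) where

    -- The subset of Fin n cut out by a decidable predicate.
    subset : Subset n
    subset = Vec.tabulate (does ∘ P?)

    ∈-subset⁺ : ∀ {v} → P v → v ∈ subset
    ∈-subset⁺ {v} pv = Vec.lookup⇒[]= v subset
      (trans (Vec.lookup∘tabulate (does ∘ P?) v) (Dec.dec-true (P? v) pv))

    ∈-subset⁻ : ∀ {v} → v ∈ subset → P v
    ∈-subset⁻ {v} v∈
      with P? v | trans (sym (Vec.lookup∘tabulate (does ∘ P?) v)) (Vec.[]=⇒lookup v∈)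
    ... | yes pv | _ = pv

  ∣subset∣ : {P : Fin n → Set p} (P? : U.Decidable P) → ∣ subset P? ∣ ≡ ∑[ v < n ] χ (P? v)
  ∣subset∣ {n = zero}  P? = refl
  ∣subset∣ {n = suc n} P? with does (P? zero)
  ... | true  = cong suc (∣subset∣ (P? ∘ suc))
  ... | false = ∣subset∣ (P? ∘ suc)

  module _ {R : Rel A ℓ} where

    allPairs-lookup : {xs : Vec A m} → AllPairs R xs → ∀ i j → i Fin.< j →
                      R (lookup xs i) (lookup xs j)
    allPairs-lookup (Rx ∷ Rxs) zero    (suc j) i<j = All.lookup⁺ Rx j
    allPairs-lookup (Rx ∷ Rxs) (suc i) (suc j) i<j = allPairs-lookup Rxs i j (s<s⁻¹ i<j)

    allPairs-tabulate : (xs : Vec A m) → (∀ i j → i Fin.< j → R (lookup xs i) (lookup xs j)) →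
                        AllPairs R xs
    allPairs-tabulate []       r = []
    allPairs-tabulate (x ∷ xs) r =
      All.lookup⁻ (λ j → r zero (suc j) z<s)
      ∷ allPairs-tabulate xs (λ i j i<j → r (suc i) (suc j) (s<s i<j))

  -- v is an entry of the vector.
  Occurs : Vec A m → A → Set _
  Occurs as v = ∃ λ i → lookup as i ≡ v

  occurs? : (as : Vec (Fin n) m) → U.Decidable (Occurs as)
  occurs? as v = Fin.any? λ i → lookup as i Fin.≟ v

  -- u occurs at an earlier position than v.
  Precedes : Vec A m → A → A → Set _
  Precedes as u v = ∃₂ λ i j → i Fin.< j × lookup as i ≡ u × lookup as j ≡ v

  precedes? : (as : Vec (Fin n) m) → Decidable (Precedes as)
  precedes? as u v = Fin.any? λ i → Fin.any? λ j →
    i Fin.<? j ×-dec lookup as i Fin.≟ u ×-dec lookup as j Fin.≟ v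

  -- The subdigraph with the entries of a vector as vertices and an arc from each
  -- entry to each later one.
  listed : Vec (Fin n) m → Subdigraph n
  listed as = subdigraph (subset (occurs? as)) (Vec.tabulate λ u → subset (precedes? as u))

  module _ (as : Vec (Fin n) m) where

    private
      row : ∀ u → lookup (Subdigraph.arcs (listed as)) u ≡ subset (precedes? as u)
      row = Vec.lookup∘tabulate (λ u → subset (precedes? as u))

    listed-arc⁺ : ∀ {u v} → Precedes as u v → Subdigraph.Arc (listed as) u v
    listed-arc⁺ {u} {v} uv = subst (v ∈_) (sym (row u)) (∈-subset⁺ (precedes? as u) uv)

    listed-arc⁻ : ∀ {u v} → Subdigraph.Arc (listed as) u v → Precedes as u v
    listed-arc⁻ {u} {v} uv = ∈-subset⁻ (precedes? as u) (subst (v ∈_) (row u) uv)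

  subset-ext : {s t : Subset n} → (∀ v → v ∈ s → v ∈ t) → (∀ v → v ∈ t → v ∈ s) → s ≡ t
  subset-ext s⊆t t⊆s = ⊆-antisym (λ {v} → s⊆t v) (λ {v} → t⊆s v)

  vec-ext : {xs ys : Vec A n} → lookup xs ≗ lookup ys → xs ≡ ys
  vec-ext {xs = xs} {ys} eq = trans (sym (Vec.tabulate∘lookup xs))
    (trans (Vec.tabulate-cong eq) (Vec.tabulate∘lookup ys))

  -- A transitive tournament is determined by any of its transitive listings.
  listing⇒≡listed : {H : Subdigraph n} {as : Vec (Fin n) m} →
    (∀ u v → Subdigraph.Arc H u v → u ∈ Subdigraph.vertices H × v ∈ Subdigraph.vertices H) →
    IsTournament H → IsTransitiveListing H as → H ≡ listed as
  listing⇒≡listed {H = H} {as} inside (loopless , tourn) (covers , ordered) =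
    cong₂ subdigraph
      (subset-ext (λ v → ∈-subset⁺ (occurs? as) ∘ Equivalence.to (covers v))
                  (λ v → Equivalence.from (covers v) ∘ ∈-subset⁻ (occurs? as)))
      (vec-ext λ u → subset-ext (λ v → listed-arc⁺ as ∘ arc⇒precedes u v)
                                (λ v → precedes⇒arc u v ∘ listed-arc⁻ as))
    where
    open Subdigraph H using (Arc)
    precedes⇒arc : ∀ u v → Precedes as u v → Arc u v
    precedes⇒arc _ _ (i , j , i<j , refl , refl) = ordered i j i<j

    arc⇒precedes : ∀ u v → Arc u v → Precedes as u v
    arc⇒precedes u v uv with inside u v uv
    ... | u∈ , v∈ with Equivalence.to (covers u) u∈ | Equivalence.to (covers v) v∈
    ... | i , refl | j , refl with Fin.<-cmp i j
    ... | tri< i<j _ _  = i , j , i<j , refl , refl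
    ... | tri≈ _ refl _ = contradiction uv (loopless _)
    ... | tri> _ _ j<i with tourn _ _ u∈ v∈ (λ eq → loopless _ (subst (Arc _) (sym eq) uv))
    ...   | inj₁ (_ , ¬vu) = contradiction (ordered j i j<i) ¬vu
    ...   | inj₂ (¬uv , _) = contradiction uv ¬uv

  module _ {E : Rel (Fin n) ℓ} (irr : ∀ u → ¬ E u u) (asym : Asymmetric E) where

    lookup-injective : {as : Vec (Fin n) m} → AllPairs E as →
                       ∀ i j → lookup as i ≡ lookup as j → i ≡ j
    lookup-injective as! i j eq with Fin.<-cmp i j
    ... | tri< i<j _ _ = contradiction (subst (E _) (sym eq) (allPairs-lookup as! i j i<j)) (irr _)
    ... | tri≈ _ i≡j _ = i≡j
    ... | tri> _ _ j<i = contradiction (subst (E _) eq (allPairs-lookup as! j i j<i)) (irr _)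

    -- An asymmetric irreflexive relation orders a given set of vertices in at most
    -- one way: each head occurs in the other vector, and if the heads differed each
    -- would precede the other.
    allPairs-unique : {as bs : Vec (Fin n) m} → AllPairs E as → AllPairs E bs →
      (∀ v → Occurs as v → Occurs bs v) → (∀ v → Occurs bs v → Occurs as v) → as ≡ bs
    allPairs-unique {as = []}     {[]}     _          _          _ _ = refl
    allPairs-unique {as = a ∷ as} {b ∷ bs} (Ea ∷ as!) (Eb ∷ bs!) f g =
      cong₂ _∷_ a≡b (allPairs-unique as! bs!
        (λ v v∈ → drop a≡b Ea v v∈ (f v (weaken v∈)))
        (λ v v∈ → drop (sym a≡b) Eb v v∈ (g v (weaken v∈))))
      where
      weaken : ∀ {m x v} {xs : Vec (Fin n) m} → Occurs xs v → Occurs (x ∷ xs) v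
      weaken (i , eq) = suc i , eq

      a≡b : a ≡ b
      a≡b with f a (zero , refl) | g b (zero , refl)
      ... | zero  , b≡a | _           = sym b≡a
      ... | suc _ , _   | zero  , a≡b = a≡b
      ... | suc i , eqᵢ | suc j , eqⱼ = contradiction
        (subst (E b) eqᵢ (All.lookup⁺ Eb i))
        (asym (subst (E a) eqⱼ (All.lookup⁺ Ea j)))

      drop : ∀ {m a b} {as bs : Vec (Fin n) m} → a ≡ b → All (E a) as →
             ∀ v → Occurs as v → Occurs (b ∷ bs) v → Occurs bs v
      drop refl Ea v (i , refl) (zero  , a≡v) =
        contradiction (subst (E _) (sym a≡v) (All.lookup⁺ Ea i)) (irr _)
      drop refl Ea v v∈         (suc j , eq)  = j , eq

    -- The entries are distinct, so each vertex accounts for exactly one position.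
    ∣listed∣ : {as : Vec (Fin n) m} → AllPairs E as → ∣ Subdigraph.vertices (listed as) ∣ ≡ m
    ∣listed∣ {m = m} {as} as! = begin
      ∣ subset (occurs? as) ∣       ≡⟨ ∣subset∣ (occurs? as) ⟩
      ∑[ v < n ] χ (occurs? as v)   ≡⟨ sum-cong-≗ count ⟩
      ∑[ v < n ] ∑[ i < m ] δ i v   ≡⟨ ∑-comm (λ v i → δ i v) ⟩
      ∑[ i < m ] ∑[ v < n ] δ i v   ≡⟨ sum-cong-≗ (λ i → ∑-δ (λ _ → 1) (lookup as i)) ⟩
      ∑[ i < m ] 1                  ≡⟨ ∑-one m ⟩
      m                             ∎
      where
      open ≡-Reasoning
      δ : Fin m → Fin n → ℕ
      δ i v = 1 * χ (lookup as i Fin.≟ v)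
      count : ∀ v → χ (occurs? as v) ≡ ∑[ i < m ] δ i v
      count v = aux (occurs? as v)
        where
        aux : (d : Dec (Occurs as v)) → χ d ≡ ∑[ i < m ] δ i v
        aux (yes (i , refl)) = trans (sym (∑-δ (λ _ → 1) i))
          (sum-cong-≗ λ j → cong (1 *_)
            (χ-cong (i Fin.≟ j) (lookup as j Fin.≟ lookup as i)
                    (λ { refl → refl }) (sym ∘ lookup-injective as! j i)))
        aux (no v∉) = sym (∑-zero λ i → cong (1 *_) (χ-no (lookup as i Fin.≟ v) (v∉ ∘ (i ,_))))

  module _ (G : Digraph ℓ n) (irr : ∀ u → ¬ Digraph.Edge G u u)
           (asym : Asymmetric (Digraph.Edge G)) where

    open Digraph G

    listed-isTransitiveSubtournament : {as : Vec (Fin n) m} → AllPairs Edge as →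
                                       IsTransitiveSubtournament G m (listed as)
    listed-isTransitiveSubtournament {as = as} as! =
      contained , (loopless , tourn) , ∣listed∣ irr asym as! ,
      as , (λ v → mk⇔ (∈-subset⁻ (occurs? as)) (∈-subset⁺ (occurs? as))) ,
      (λ i j i<j → listed-arc⁺ as (i , j , i<j , refl , refl))
      where
      open Subdigraph (listed as)
      arc⇒edge : ∀ {u v} → Arc u v → Edge u v
      arc⇒edge uv with listed-arc⁻ as uv
      ... | i , j , i<j , refl , refl = allPairs-lookup as! i j i<j

      contained : listed as ContainedIn G
      contained u v uv with listed-arc⁻ as uv
      ... | i , j , i<j , refl , refl =
        ∈-subset⁺ (occurs? as) (i , refl) , ∈-subset⁺ (occurs? as) (j , refl) , arc⇒edge uv

      loopless : ∀ u → ¬ Arc u u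
      loopless u uu = irr u (arc⇒edge uu)

      one-way : ∀ {u v} → Arc u v → ¬ Arc v u
      one-way uv vu = asym (arc⇒edge uv) (arc⇒edge vu)

      tourn : ∀ u v → u ∈ vertices → v ∈ vertices → u ≢ v →
              (Arc u v × ¬ Arc v u) ⊎ (¬ Arc u v × Arc v u)
      tourn u v u∈ v∈ u≢v with ∈-subset⁻ (occurs? as) u∈ | ∈-subset⁻ (occurs? as) v∈
      ... | i , refl | j , refl with Fin.<-cmp i j
      ... | tri< i<j _ _  = let uv = listed-arc⁺ as (i , j , i<j , refl , refl) in
                            inj₁ (uv , one-way uv)
      ... | tri≈ _ refl _ = contradiction refl u≢v
      ... | tri> _ _ j<i  = let vu = listed-arc⁺ as (j , i , j<i , refl , refl) in
                            inj₂ (one-way vu , vu)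

    isTransitiveSubtournament⇒listed : (H : Subdigraph n) → IsTransitiveSubtournament G m H →
                                       ∃ λ as → AllPairs Edge as × H ≡ listed {m = m} as
    isTransitiveSubtournament⇒listed H (contained , tourn , _ , as , listing@(_ , ordered)) =
      as ,
      allPairs-tabulate as (λ i j i<j → proj₂ (proj₂ (contained _ _ (ordered i j i<j)))) ,
      listing⇒≡listed {as = as}
        (λ u v uv → let u∈ , v∈ , _ = contained u v uv in u∈ , v∈) tourn listing

    listed-injective : {as bs : Vec (Fin n) m} → AllPairs Edge as → AllPairs Edge bs →
                       listed as ≡ listed bs → as ≡ bs
    listed-injective {as = as} {bs} as! bs! eq = allPairs-unique irr asym as! bs!
      (λ v → ∈-subset⁻ (occurs? bs)
            ∘ subst (λ H → v ∈ Subdigraph.vertices H) eq ∘ ∈-subset⁺ (occurs? as))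
      (λ v → ∈-subset⁻ (occurs? as)
            ∘ subst (λ H → v ∈ Subdigraph.vertices H) (sym eq) ∘ ∈-subset⁺ (occurs? bs))

    -- Sending a vector to its listed subdigraph is a bijection from the vectors
    -- increasing for the edge relation onto the transitive subtournaments.
    𝒦≡chains : ∀ m → 𝒦 m G ≡ chains (λ u v → χ (edge? u v)) m (λ _ → 1)
    𝒦≡chains m = begin
      length (filter sub? (allSubdigraphs n))
        ≡⟨ ↭-length (∼bag⇒↭ (unique∧set⇒bag
             (Unique.filter⁺ sub? (allSubdigraphs-unique n)) listed! (mk⇔ to from))) ⟩
      length (List.map listed tuples)
        ≡⟨ List.length-map listed tuples ⟩
      length tuples
        ≡⟨ length-filter-allPairs edge? m ⟩
      chains (λ u v → χ (edge? u v)) m (λ _ → 1) ∎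
      where
      open ≡-Reasoning
      sub? = isTransitiveSubtournament? G m
      tuples = filter (allPairs? edge?) (allVecs (allFin n) m)
      listed! : Unique (List.map listed tuples)
      listed! = map⁺-Unique listed listed-injective
        (ListAll.all-filter (allPairs? edge?) (allVecs (allFin n) m))
        (Unique.filter⁺ (allPairs? edge?) (allVecs-unique (Unique.allFin⁺ n) m))
      to : ∀ {H} → H ∈ₗ filter sub? (allSubdigraphs n) → H ∈ₗ List.map listed tuples
      to {H} H∈ with isTransitiveSubtournament⇒listed H
                       (proj₂ (∈-filter⁻ sub? {xs = allSubdigraphs n} H∈))
      ... | as , as! , refl =
        ∈-map⁺ listed (∈-filter⁺ (allPairs? edge?) (∈-allVecs ∈-allFin as) as!)
      from : ∀ {H} → H ∈ₗ List.map listed tuples → H ∈ₗ filter sub? (allSubdigraphs n)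
      from H∈ with ∈-map⁻ listed H∈
      ... | as , as∈ , refl = ∈-filter⁺ sub? (∈-allSubdigraphs (listed as))
        (listed-isTransitiveSubtournament
          (proj₂ (∈-filter⁻ (allPairs? edge?) {xs = allVecs (allFin n) m} as∈)))

open Subtournaments

-- Squares in a finite field and the Paley tournament

module Paley {c ℓ} {q : ℕ} (F : FiniteField c ℓ q) where

  open import Data.Nat.Base using (_+_; _*_)

  -- The field operations are written ⊕, ⊗ and ⊖; + and * act on cardinalities.
  open FiniteField F renaming
    ( _+_ to _⊕_; _*_ to _⊗_; -_ to ⊖_; _-_ to _⊖_
    ; refl to ≈-refl; sym to ≈-sym; trans to ≈-trans
    ; +-cong to ⊕-cong; *-cong to ⊗-cong; *-comm to ⊗-comm; *-assoc to ⊗-assoc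
    ; +-assoc to ⊕-assoc; distribˡ to ⊗-distribˡ-⊕
    ; reflexive to ≈-reflexive; +-identityʳ to ⊕-identityʳ
    ; *-identityˡ to ⊗-identityˡ; *-identityʳ to ⊗-identityʳ
    ; zeroʳ to ⊗-zeroʳ
    ; -‿inverseˡ to ⊖-inverseˡ; -‿inverseʳ to ⊖-inverseʳ; -‿cong to ⊖-cong)
  open import Algebra.Properties.Ring ring
    using (x[y-z]≈xy-xz; -1*x≈-x; -‿distribˡ-*; -‿distribʳ-*)
  open import Algebra.Properties.AbelianGroup +-abelianGroup
    using (xyx⁻¹≈y)
    renaming ( ⁻¹-involutive to ⊖-involutive; ⁻¹-anti-homo‿- to ⊖[x⊖y]≈y⊖x
             ; x∙y⁻¹≈ε⇒x≈y to x⊖y≈0⇒x≈y; x≈y⇒x∙y⁻¹≈ε to x≈y⇒x⊖y≈0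
             ; ε⁻¹≈ε to ⊖0≈0)

  private module ≈-Reasoning = SetoidReasoning setoid

  -- Sums over the field

  index-element : ∀ i → index (element i) ≡ i
  index-element i = Inverse.inverseʳ enumeration ≈-refl

  -- The function respects the equality of the field.
  Extensional : (Carrier → ℕ) → Set _
  Extensional f = ∀ {x y} → x ≈ y → f x ≡ f y

  -- The sum of a function over all field elements.
  ∑F : (Carrier → ℕ) → ℕ
  ∑F f = ∑[ i < q ] f (element i)

  ∑F-cong : {f g : Carrier → ℕ} → f ≗ g → ∑F f ≡ ∑F g
  ∑F-cong f≗g = sum-cong-≗ (f≗g ∘ element)

  -- Invariance of sums under a permutation of the field, given with its inverse.
  ∑F-reindex : {f : Carrier → ℕ} → Extensional f → (to from : Carrier → Carrier) →
    (∀ {x y} → x ≈ y → to x ≈ to y) → (∀ {x y} → x ≈ y → from x ≈ from y) →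
    (∀ x → to (from x) ≈ x) → (∀ x → from (to x) ≈ x) → ∑F f ≡ ∑F (f ∘ to)
  ∑F-reindex {f} f-ext to from to-cong from-cong to-from from-to = trans
    (∑-permute (f ∘ element) (permutation (conj to) (conj from)
      (cancel to from to-cong to-from) (cancel from to from-cong from-to)))
    (sum-cong-≗ λ i → f-ext (element-index (to (element i))))
    where
    conj : (Carrier → Carrier) → Fin q → Fin q
    conj g i = index (g (element i))
    cancel : (g h : Carrier → Carrier) → (∀ {x y} → x ≈ y → g x ≈ g y) →
             (∀ x → g (h x) ≈ x) → ∀ i → conj g (conj h i) ≡ i
    cancel g h g-cong gh i = trans
      (Inverse.from-cong enumeration
        (≈-trans (g-cong (element-index (h (element i)))) (gh (element i))))
      (index-element i)

  ∑F-δ : {f : Carrier → ℕ} → Extensional f → ∀ x → ∑F (λ y → f y * χ (x ≈? y)) ≡ f x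
  ∑F-δ {f} f-ext x = begin
    ∑F (λ y → f y * χ (x ≈? y))
      ≡⟨ sum-cong-≗ (λ j →
             cong (λ k → f (element j) * χ (index x Fin.≟ k)) (index-element j)) ⟩
    ∑[ j < q ] (f (element j) * χ (index x Fin.≟ j))
      ≡⟨ ∑-δ (f ∘ element) (index x) ⟩
    f (element (index x))
      ≡⟨ f-ext (element-index x) ⟩
    f x ∎
    where open ≡-Reasoning

  -- The parity principle for involutions, transported to field elements.
  ∑F-involution : {w : Carrier → ℕ} → Extensional w → (σ : Carrier → Carrier) →
    (∀ {x y} → x ≈ y → σ x ≈ σ y) → (∀ x → σ (σ x) ≈ x) →
    (∀ x → w (σ x) ≡ w x) → (∀ x → w x ≡ 0 ⊎ ¬ σ x ≈ x) →
    ∃ λ k → ∑F w ≡ k + k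
  ∑F-involution {w} w-ext σ σ-cong σσ wσ fp = ∑-involution
    (λ i → index (σ (element i)))
    (λ i → trans (Inverse.from-cong enumeration
                   (≈-trans (σ-cong (element-index _)) (σσ (element i)))) (index-element i))
    (w ∘ element)
    (λ i → trans (w-ext (element-index _)) (wσ (element i)))
    (λ i → fixed i (fp (element i)))
    where
    fixed : ∀ i → w (element i) ≡ 0 ⊎ ¬ σ (element i) ≈ element i →
            w (element i) ≡ 0 ⊎ index (σ (element i)) ≢ i
    fixed i (inj₁ w≡0) = inj₁ w≡0
    fixed i (inj₂ σx≉x) = inj₂ λ eq → σx≉x
      (≈-trans (≈-sym (element-index _)) (≈-reflexive (cong element eq)))

  -- Arithmetic of squares

  inv-cancel : ∀ {d d⁻¹} → d ⊗ d⁻¹ ≈ 1# → ∀ x → d ⊗ (d⁻¹ ⊗ x) ≈ x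
  inv-cancel dd⁻¹ x = ≈-trans (≈-sym (⊗-assoc _ _ _))
    (≈-trans (⊗-cong dd⁻¹ ≈-refl) (⊗-identityˡ x))

  xy≈0⇒x≈0⊎y≈0 : ∀ x y → x ⊗ y ≈ 0# → x ≈ 0# ⊎ y ≈ 0#
  xy≈0⇒x≈0⊎y≈0 x y xy≈0 with x ≈? 0#
  ... | yes x≈0 = inj₁ x≈0
  ... | no x≉0  = let x⁻¹ , xx⁻¹≈1 = inverse x x≉0 in inj₂ (begin
    y               ≈⟨ inv-cancel (≈-trans (⊗-comm x⁻¹ x) xx⁻¹≈1) y ⟨
    x⁻¹ ⊗ (x ⊗ y)   ≈⟨ ⊗-cong ≈-refl xy≈0 ⟩
    x⁻¹ ⊗ 0#        ≈⟨ ⊗-zeroʳ x⁻¹ ⟩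
    0#              ∎)
    where open ≈-Reasoning

  ⊖x⊗⊖x≈x⊗x : ∀ x → ⊖ x ⊗ ⊖ x ≈ x ⊗ x
  ⊖x⊗⊖x≈x⊗x x = begin
    ⊖ x ⊗ ⊖ x      ≈⟨ -‿distribˡ-* x (⊖ x) ⟨
    ⊖ (x ⊗ ⊖ x)    ≈⟨ ⊖-cong (-‿distribʳ-* x x) ⟨
    ⊖ (⊖ (x ⊗ x))  ≈⟨ ⊖-involutive (x ⊗ x) ⟩
    x ⊗ x          ∎
    where open ≈-Reasoning

  x²≈y²⇒x≈±y : ∀ x y → x ⊗ x ≈ y ⊗ y → x ≈ y ⊎ x ≈ ⊖ y
  x²≈y²⇒x≈±y x y x²≈y² with xy≈0⇒x≈0⊎y≈0 (x ⊖ y) (x ⊕ y) (begin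
      (x ⊖ y) ⊗ (x ⊕ y)
        ≈⟨ ⊗-distribˡ-⊕ (x ⊖ y) x y ⟩
      (x ⊖ y) ⊗ x ⊕ (x ⊖ y) ⊗ y
        ≈⟨ ⊕-cong (⊗-comm _ _) (⊗-comm _ _) ⟩
      x ⊗ (x ⊖ y) ⊕ y ⊗ (x ⊖ y)
        ≈⟨ ⊕-cong (x[y-z]≈xy-xz x x y) (x[y-z]≈xy-xz y x y) ⟩
      (x ⊗ x ⊖ x ⊗ y) ⊕ (y ⊗ x ⊖ y ⊗ y)
        ≈⟨ ⊕-cong (⊕-cong x²≈y² (⊖-cong (⊗-comm x y))) ≈-refl ⟩
      (y ⊗ y ⊖ y ⊗ x) ⊕ (y ⊗ x ⊖ y ⊗ y)
        ≈⟨ ⊕-cong (⊖[x⊖y]≈y⊖x (y ⊗ x) (y ⊗ y)) ≈-refl ⟨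
      ⊖ (y ⊗ x ⊖ y ⊗ y) ⊕ (y ⊗ x ⊖ y ⊗ y)
        ≈⟨ ⊖-inverseˡ _ ⟩
      0# ∎)
    where open ≈-Reasoning
  ... | inj₁ x⊖y≈0 = inj₁ (x⊖y≈0⇒x≈y x y x⊖y≈0)
  ... | inj₂ x⊕y≈0 = inj₂ (x⊖y≈0⇒x≈y x (⊖ y)
          (≈-trans (⊕-cong ≈-refl (⊖-involutive y)) x⊕y≈0))

  x≈0⇒yx≈0 : ∀ {x} y → x ≈ 0# → y ⊗ x ≈ 0#
  x≈0⇒yx≈0 y x≈0 = ≈-trans (⊗-cong ≈-refl x≈0) (⊗-zeroʳ y)

  square-cong : ∀ {x y} → x ≈ y → IsNonzeroSquare x → IsNonzeroSquare y
  square-cong x≈y (x≉0 , r , rr≈x) =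
    (λ y≈0 → x≉0 (≈-trans x≈y y≈0)) , r , ≈-trans rr≈x x≈y

  square-⊗ : ∀ {x y} → IsNonzeroSquare x → IsNonzeroSquare y → IsNonzeroSquare (x ⊗ y)
  square-⊗ {x} {y} (x≉0 , r , rr≈x) (y≉0 , t , tt≈y) = xy≉0 , r ⊗ t , (begin
    (r ⊗ t) ⊗ (r ⊗ t)  ≈⟨ ⊗-assoc r t (r ⊗ t) ⟩
    r ⊗ (t ⊗ (r ⊗ t))  ≈⟨ ⊗-cong ≈-refl (⊗-cong ≈-refl (⊗-comm r t)) ⟩
    r ⊗ (t ⊗ (t ⊗ r))  ≈⟨ ⊗-cong ≈-refl (⊗-assoc t t r) ⟨
    r ⊗ ((t ⊗ t) ⊗ r)  ≈⟨ ⊗-cong ≈-refl (⊗-comm (t ⊗ t) r) ⟩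
    r ⊗ (r ⊗ (t ⊗ t))  ≈⟨ ⊗-assoc r r (t ⊗ t) ⟨
    (r ⊗ r) ⊗ (t ⊗ t)  ≈⟨ ⊗-cong rr≈x tt≈y ⟩
    x ⊗ y              ∎)
    where
    open ≈-Reasoning
    xy≉0 : ¬ x ⊗ y ≈ 0#
    xy≉0 xy≈0 with xy≈0⇒x≈0⊎y≈0 x y xy≈0
    ... | inj₁ x≈0 = x≉0 x≈0
    ... | inj₂ y≈0 = y≉0 y≈0

  square-inverse : ∀ {d d⁻¹} → d ⊗ d⁻¹ ≈ 1# → IsNonzeroSquare d → IsNonzeroSquare d⁻¹
  square-inverse {d} {d⁻¹} dd⁻¹≈1 d□@(d≉0 , r , rr≈d) =
    d⁻¹≉0 , d⁻¹ ⊗ r , (begin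
    (d⁻¹ ⊗ r) ⊗ (d⁻¹ ⊗ r)  ≈⟨ ⊗-assoc d⁻¹ r (d⁻¹ ⊗ r) ⟩
    d⁻¹ ⊗ (r ⊗ (d⁻¹ ⊗ r))  ≈⟨ ⊗-cong ≈-refl (⊗-cong ≈-refl (⊗-comm d⁻¹ r)) ⟩
    d⁻¹ ⊗ (r ⊗ (r ⊗ d⁻¹))  ≈⟨ ⊗-cong ≈-refl (⊗-assoc r r d⁻¹) ⟨
    d⁻¹ ⊗ ((r ⊗ r) ⊗ d⁻¹)  ≈⟨ ⊗-cong ≈-refl (⊗-cong rr≈d ≈-refl) ⟩
    d⁻¹ ⊗ (d ⊗ d⁻¹)        ≈⟨ ⊗-cong ≈-refl dd⁻¹≈1 ⟩
    d⁻¹ ⊗ 1#               ≈⟨ ⊗-identityʳ d⁻¹ ⟩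
    d⁻¹                    ∎)
    where
    open ≈-Reasoning
    d⁻¹≉0 : ¬ d⁻¹ ≈ 0#
    d⁻¹≉0 d⁻¹≈0 = 0≉1 (≈-trans (≈-sym (x≈0⇒yx≈0 d d⁻¹≈0)) dd⁻¹≈1)

  -- The indicator of the nonzero squares.
  □ : Carrier → ℕ
  □ x = χ (isNonzeroSquare? x)

  □-ext : Extensional □
  □-ext {x} {y} x≈y = χ-cong (isNonzeroSquare? x) (isNonzeroSquare? y)
    (square-cong x≈y) (square-cong (≈-sym x≈y))

  -- Multiplication by a nonzero square preserves the nonzero squares in both
  -- directions.
  □-scale : ∀ {d} → IsNonzeroSquare d → ∀ x → □ (d ⊗ x) ≡ □ x
  □-scale {d} d□@(d≉0 , _) x = let d⁻¹ , dd⁻¹≈1 = inverse d d≉0 in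
    χ-cong (isNonzeroSquare? (d ⊗ x)) (isNonzeroSquare? x)
      (λ dx□ → square-cong (inv-cancel (≈-trans (⊗-comm d⁻¹ d) dd⁻¹≈1) x)
                 (square-⊗ (square-inverse dd⁻¹≈1 d□) dx□))
      (square-⊗ d□)

  -- The number of nonzero squares.
  S : ℕ
  S = ∑F □

  -- The number of nonzero squares x for which x - 1 is also a nonzero square.
  M : ℕ
  M = ∑F (λ x → □ x * □ (x ⊖ 1#))

  x⊕a⊖a≈x : ∀ x a → x ⊕ a ⊖ a ≈ x
  x⊕a⊖a≈x x a = ≈-trans (⊕-assoc x a (⊖ a))
    (≈-trans (⊕-cong ≈-refl (⊖-inverseʳ a)) (⊕-identityʳ x))

  ∑F-translate : {f : Carrier → ℕ} → Extensional f → ∀ a → ∑F f ≡ ∑F (λ x → f (x ⊕ a))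
  ∑F-translate f-ext a = ∑F-reindex f-ext (_⊕ a) (_⊖ a)
    (λ x≈y → ⊕-cong x≈y ≈-refl) (λ x≈y → ⊕-cong x≈y ≈-refl)
    (λ x → ≈-trans (⊕-assoc x (⊖ a) a) (≈-trans (⊕-cong ≈-refl (⊖-inverseˡ a)) (⊕-identityʳ x)))
    (λ x → x⊕a⊖a≈x x a)

  ∑F-scale : {f : Carrier → ℕ} → Extensional f → ∀ {d} → ¬ d ≈ 0# →
    ∑F f ≡ ∑F (λ x → f (d ⊗ x))
  ∑F-scale f-ext {d} d≉0 = let d⁻¹ , dd⁻¹≈1 = inverse d d≉0 in
    ∑F-reindex f-ext (d ⊗_) (d⁻¹ ⊗_) (⊗-cong ≈-refl) (⊗-cong ≈-refl)
      (inv-cancel dd⁻¹≈1) (inv-cancel (≈-trans (⊗-comm d⁻¹ d) dd⁻¹≈1))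

  -- Scaling by d reduces a shift by any nonzero square d to a shift by 1.
  shifted-squares : ∀ {d} → IsNonzeroSquare d → ∑F (λ x → □ x * □ (x ⊖ d)) ≡ M
  shifted-squares {d} d□@(d≉0 , _) = trans
    (∑F-scale (λ x≈y → cong₂ _*_ (□-ext x≈y) (□-ext (⊕-cong x≈y ≈-refl))) d≉0)
    (∑F-cong λ x → cong₂ _*_ (□-scale d□ x) (trans
      (□-ext (≈-sym (≈-trans (x[y-z]≈xy-xz d x 1#) (⊕-cong ≈-refl (⊖-cong (⊗-identityʳ d))))))
      (□-scale d□ (x ⊖ 1#))))

  -- For an arc a → b, the number of vertices x with a → x and b → x does not
  -- depend on the arc.
  common-successors : ∀ a b → IsNonzeroSquare (b ⊖ a) → ∑F (λ x → □ (x ⊖ a) * □ (x ⊖ b)) ≡ M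
  common-successors a b ab□ = begin
    ∑F (λ x → □ (x ⊖ a) * □ (x ⊖ b))
      ≡⟨ ∑F-translate (λ x≈y → cong₂ _*_ (□-ext (⊕-cong x≈y ≈-refl))
                                           (□-ext (⊕-cong x≈y ≈-refl))) a ⟩
    ∑F (λ x → □ (x ⊕ a ⊖ a) * □ (x ⊕ a ⊖ b))
      ≡⟨ ∑F-cong (λ x → cong₂ _*_
           (□-ext (x⊕a⊖a≈x x a))
           (□-ext (≈-trans (⊕-assoc x a (⊖ b)) (⊕-cong ≈-refl (≈-sym (⊖[x⊖y]≈y⊖x b a)))))) ⟩
    ∑F (λ x → □ x * □ (x ⊖ (b ⊖ a)))
      ≡⟨ shifted-squares ab□ ⟩
    M ∎
    where open ≡-Reasoning

  -- Consequences of q = 4j + 3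

  module Order≡3mod4 (j : ℕ) (q≡3+4j : q ≡ 3 + j * 4) where

    odd : ∀ k → q ≢ k + k
    odd k q≡k+k = k+k≢1+2j k (1 + j * 2) (trans (sym q≡k+k) (trans q≡3+4j (halve j)))
      where
      halve : ∀ j → 3 + j * 4 ≡ suc (2 * (1 + j * 2))
      halve = solve-∀

    -- In characteristic two, x ↦ x + 1 would be an involution without fixed points
    -- on a set of odd size.
    1⊕1≉0 : ¬ 1# ⊕ 1# ≈ 0#
    1⊕1≉0 2≈0 = odd (proj₁ even) (trans (sym (∑-one q)) (proj₂ even))
      where
      open ≈-Reasoning
      even : ∃ λ k → ∑F (λ _ → 1) ≡ k + k
      even = ∑F-involution (λ _ → refl) (_⊕ 1#) (λ x≈y → ⊕-cong x≈y ≈-refl)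
        (λ x → ≈-trans (⊕-assoc x 1# 1#) (≈-trans (⊕-cong ≈-refl 2≈0) (⊕-identityʳ x)))
        (λ _ → refl)
        (λ x → inj₂ λ x+1≈x → 0≉1 (begin
          0#            ≈⟨ x≈y⇒x⊖y≈0 x+1≈x ⟨
          x ⊕ 1# ⊖ x    ≈⟨ xyx⁻¹≈y x 1# ⟩
          1#            ∎))

    x≉⊖x : ∀ {x} → ¬ x ≈ 0# → ¬ ⊖ x ≈ x
    x≉⊖x {x} x≉0 -x≈x with xy≈0⇒x≈0⊎y≈0 x (1# ⊕ 1#) (begin
        x ⊗ (1# ⊕ 1#)      ≈⟨ ⊗-distribˡ-⊕ x 1# 1# ⟩
        x ⊗ 1# ⊕ x ⊗ 1#    ≈⟨ ⊕-cong (⊗-identityʳ x) (⊗-identityʳ x) ⟩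
        x ⊕ x              ≈⟨ ⊕-cong -x≈x ≈-refl ⟨
        ⊖ x ⊕ x            ≈⟨ ⊖-inverseˡ x ⟩
        0#                 ∎)
      where open ≈-Reasoning
    ... | inj₁ x≈0 = x≉0 x≈0
    ... | inj₂ 2≈0 = 1⊕1≉0 2≈0

    two-roots : ∀ {x} → IsNonzeroSquare x → ∑F (λ y → χ (y ⊗ y ≈? x)) ≡ 2
    two-roots {x} (x≉0 , r , rr≈x) = begin
      ∑F (λ y → χ (y ⊗ y ≈? x))
        ≡⟨ ∑F-cong split ⟩
      ∑F (λ y → 1 * χ (r ≈? y) + 1 * χ (⊖ r ≈? y))
        ≡⟨ ∑-distrib-+ (λ i → 1 * χ (r ≈? element i)) (λ i → 1 * χ (⊖ r ≈? element i)) ⟩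
      ∑F (λ y → 1 * χ (r ≈? y)) + ∑F (λ y → 1 * χ (⊖ r ≈? y))
        ≡⟨ cong₂ _+_ (∑F-δ {λ _ → 1} (λ _ → refl) r) (∑F-δ {λ _ → 1} (λ _ → refl) (⊖ r)) ⟩
      2 ∎
      where
      open ≡-Reasoning
      r≉0 : ¬ r ≈ 0#
      r≉0 r≈0 = x≉0 (≈-trans (≈-sym rr≈x) (x≈0⇒yx≈0 r r≈0))
      split : ∀ y → χ (y ⊗ y ≈? x) ≡ 1 * χ (r ≈? y) + 1 * χ (⊖ r ≈? y)
      split y = decide (r ≈? y) (⊖ r ≈? y)
        where
        -- Decisions of field equality unfold to comparisons of indices, so the case
        -- analysis is stated for arbitrary decisions of the two equalities.
        decide : (d : Dec (r ≈ y)) (d′ : Dec (⊖ r ≈ y)) → χ (y ⊗ y ≈? x) ≡ 1 * χ d + 1 * χ d′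
        decide (yes r≈y) (yes -r≈y) = contradiction (≈-trans -r≈y (≈-sym r≈y)) (x≉⊖x r≉0)
        decide (yes r≈y) (no _)     = χ-yes (y ⊗ y ≈? x)
          (≈-trans (⊗-cong (≈-sym r≈y) (≈-sym r≈y)) rr≈x)
        decide (no _)    (yes -r≈y) = χ-yes (y ⊗ y ≈? x)
          (≈-trans (⊗-cong (≈-sym -r≈y) (≈-sym -r≈y)) (≈-trans (⊖x⊗⊖x≈x⊗x r) rr≈x))
        decide (no r≉y)  (no -r≉y)  = χ-no (y ⊗ y ≈? x) λ yy≈x →
          [ r≉y ∘ ≈-sym , -r≉y ∘ ≈-sym ] (x²≈y²⇒x≈±y y r (≈-trans yy≈x (≈-sym rr≈x)))

    one-zero : ∑F (λ x → χ (x ≈? 0#)) ≡ 1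
    one-zero = trans
      (∑F-cong λ x → trans (χ-cong (x ≈? 0#) (0# ≈? x) ≈-sym ≈-sym) (sym (ℕ.*-identityˡ _)))
      (∑F-δ {λ _ → 1} (λ _ → refl) 0#)

    -- Both sides count the field: for y ≠ 0 the element y² is a nonzero square, and
    -- each nonzero square has exactly two roots; one more element is 0.
    half-are-squares : S + S + 1 ≡ q
    half-are-squares = begin
      S + S + 1
        ≡⟨ cong₂ _+_ (double S) (sym one-zero) ⟩
      S * 2 + ∑F (λ y → χ (y ≈? 0#))
        ≡⟨ cong (_+ ∑F (λ y → χ (y ≈? 0#))) by-square ⟨
      ∑F (λ y → □ (y ⊗ y)) + ∑F (λ y → χ (y ≈? 0#))
        ≡⟨ ∑-distrib-+ (λ i → □ (element i ⊗ element i)) (λ i → χ (element i ≈? 0#)) ⟨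
      ∑F (λ y → □ (y ⊗ y) + χ (y ≈? 0#))
        ≡⟨ ∑F-cong nonzero ⟩
      ∑F (λ y → 1)
        ≡⟨ ∑-one q ⟩
      q ∎
      where
      open ≡-Reasoning
      double : ∀ k → k + k ≡ k * 2
      double = solve-∀
      nonzero : ∀ y → □ (y ⊗ y) + χ (y ≈? 0#) ≡ 1
      nonzero y = decide (y ≈? 0#)
        where
        decide : (d : Dec (y ≈ 0#)) → □ (y ⊗ y) + χ d ≡ 1
        decide (yes y≈0) = cong (_+ 1)
          (χ-no (isNonzeroSquare? (y ⊗ y)) λ (yy≉0 , _) → yy≉0 (x≈0⇒yx≈0 y y≈0))
        decide (no y≉0)  = cong (_+ 0) (χ-yes (isNonzeroSquare? (y ⊗ y))
          ((λ yy≈0 → [ y≉0 , y≉0 ] (xy≈0⇒x≈0⊎y≈0 y y yy≈0)) , y , ≈-refl))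
      weigh : ∀ x → ∑F (λ y → □ x * χ (y ⊗ y ≈? x)) ≡ □ x * 2
      weigh x = trans (sym (*-distribˡ-sum (□ x) (λ i → χ (element i ⊗ element i ≈? x))))
        (aux (isNonzeroSquare? x))
        where
        aux : (d : Dec (IsNonzeroSquare x)) → χ d * ∑F (λ y → χ (y ⊗ y ≈? x)) ≡ χ d * 2
        aux (yes x□) = cong (1 *_) (two-roots x□)
        aux (no _)   = refl
      by-square : ∑F (λ y → □ (y ⊗ y)) ≡ S * 2
      by-square = begin
        ∑F (λ y → □ (y ⊗ y))
          ≡⟨ ∑F-cong (λ y → ∑F-δ □-ext (y ⊗ y)) ⟨
        ∑F (λ y → ∑F (λ x → □ x * χ (y ⊗ y ≈? x)))
          ≡⟨ ∑-comm (λ i j → □ (element j) * χ (element i ⊗ element i ≈? element j)) ⟩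
        ∑F (λ x → ∑F (λ y → □ x * χ (y ⊗ y ≈? x)))
          ≡⟨ ∑F-cong weigh ⟩
        ∑F (λ x → □ x * 2)
          ≡⟨ *-distribʳ-sum 2 (□ ∘ element) ⟨
        S * 2 ∎

    -- If -1 is a square then negation permutes the nonzero squares, without fixed
    -- points because 2 ≠ 0.
    -1-square⇒S-even : IsNonzeroSquare (⊖ 1#) → ∃ λ k → S ≡ k + k
    -1-square⇒S-even -1□ = ∑F-involution □-ext ⊖_ ⊖-cong ⊖-involutive
      (λ x → trans (□-ext (≈-sym (-1*x≈-x x))) (□-scale -1□ x))
      (λ x → fixed x (isNonzeroSquare? x))
      where
      fixed : ∀ x (d : Dec (IsNonzeroSquare x)) → χ d ≡ 0 ⊎ ¬ ⊖ x ≈ x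
      fixed x (yes (x≉0 , _)) = inj₂ (x≉⊖x x≉0)
      fixed x (no _)          = inj₁ refl

    S≡1+2j : S ≡ suc (2 * j)
    S≡1+2j = ℕ.*-cancelˡ-≡ S (suc (2 * j)) 2 (ℕ.+-cancelʳ-≡ 1 (2 * S) (2 * suc (2 * j)) (begin
      2 * S + 1             ≡⟨ double S ⟩
      S + S + 1             ≡⟨ half-are-squares ⟩
      q                     ≡⟨ q≡3+4j ⟩
      3 + j * 4             ≡⟨ halve j ⟩
      2 * suc (2 * j) + 1   ∎))
      where
      open ≡-Reasoning
      double : ∀ k → 2 * k + 1 ≡ k + k + 1
      double = solve-∀
      halve : ∀ j → 3 + j * 4 ≡ 2 * suc (2 * j) + 1
      halve = solve-∀

    -1-nonsquare : ¬ IsNonzeroSquare (⊖ 1#)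
    -1-nonsquare -1□ = let k , S≡k+k = -1-square⇒S-even -1□ in
      k+k≢1+2j k j (trans (sym S≡k+k) S≡1+2j)

    not-both : ∀ {x} → IsNonzeroSquare x → ¬ IsNonzeroSquare (⊖ x)
    not-both {x} x□@(x≉0 , _) -x□ = let x⁻¹ , xx⁻¹≈1 = inverse x x≉0 in
      -1-nonsquare (square-cong
        (≈-trans (≈-sym (-‿distribˡ-* x x⁻¹)) (⊖-cong xx⁻¹≈1))
        (square-⊗ -x□ (square-inverse xx⁻¹≈1 x□)))

    -- At most one of the three terms is 1 at each x; since they sum to
    -- S + S + 1 = q over the whole field, exactly one is 1 everywhere.
    trichotomy : ∀ x → □ x + □ (⊖ x) + χ (x ≈? 0#) ≡ 1
    trichotomy x = trans (sym (g-ext (element-index x))) (∑-≤1-tight (g≤1 ∘ element) ∑g≡q (index x))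
      where
      open ≡-Reasoning
      g : Carrier → ℕ
      g x = □ x + □ (⊖ x) + χ (x ≈? 0#)
      g-ext : Extensional g
      g-ext {x} {y} x≈y = cong₂ _+_ (cong₂ _+_ (□-ext x≈y) (□-ext (⊖-cong x≈y)))
        (χ-cong (x ≈? 0#) (y ≈? 0#) (≈-trans (≈-sym x≈y)) (≈-trans x≈y))
      g≤1 : ∀ x → g x ≤ 1
      g≤1 x = decide (isNonzeroSquare? x) (isNonzeroSquare? (⊖ x)) (x ≈? 0#)
        where
        decide : (d : Dec (IsNonzeroSquare x)) (d′ : Dec (IsNonzeroSquare (⊖ x)))
                 (d″ : Dec (x ≈ 0#)) → χ d + χ d′ + χ d″ ≤ 1
        decide (yes x□)        (yes -x□)        _         = contradiction -x□ (not-both x□)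
        decide (yes (x≉0 , _)) _                (yes x≈0) = contradiction x≈0 x≉0
        decide (yes _)         (no _)           (no _)    = s≤s z≤n
        decide (no _)          (yes (-x≉0 , _)) (yes x≈0) =
          contradiction (≈-trans (⊖-cong x≈0) ⊖0≈0) -x≉0
        decide (no _)          (yes _)          (no _)    = s≤s z≤n
        decide (no _)          (no _)           d″        = χ-≤1 d″
      S≡∑⊖ : S ≡ ∑F (λ x → □ (⊖ x))
      S≡∑⊖ = ∑F-reindex □-ext ⊖_ ⊖_ ⊖-cong ⊖-cong ⊖-involutive ⊖-involutive
      ∑g≡q : ∑F g ≡ q
      ∑g≡q = begin
        ∑F g
          ≡⟨ ∑-distrib-+ (λ i → □ (element i) + □ (⊖ element i)) (λ i → χ (element i ≈? 0#)) ⟩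
        ∑F (λ x → □ x + □ (⊖ x)) + ∑F (λ x → χ (x ≈? 0#))
          ≡⟨ cong₂ _+_ (∑-distrib-+ (□ ∘ element) (λ i → □ (⊖ element i))) one-zero ⟩
        S + ∑F (λ x → □ (⊖ x)) + 1
          ≡⟨ cong (λ s → S + s + 1) S≡∑⊖ ⟨
        S + S + 1
          ≡⟨ half-are-squares ⟩
        q ∎

    -- The indicator of the arc relation of the Paley tournament.
    arc : Fin q → Fin q → ℕ
    arc u v = □ (element v ⊖ element u)

    arc-tournament : ∀ u v → arc u v + arc v u + χ (u Fin.≟ v) ≡ 1
    arc-tournament u v = begin
      arc u v + arc v u + χ (u Fin.≟ v)
        ≡⟨ cong₂ (λ s t → arc u v + s + t)
             (□-ext (≈-sym (⊖[x⊖y]≈y⊖x (element v) (element u))))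
             (χ-cong (u Fin.≟ v) (element v ⊖ element u ≈? 0#)
               (λ { refl → ⊖-inverseʳ (element u) })
               (λ v⊖u≈0 → trans (sym (index-element u)) (trans
                 (Inverse.from-cong enumeration (≈-sym (x⊖y≈0⇒x≈y _ _ v⊖u≈0)))
                 (index-element v)))) ⟩
      □ (element v ⊖ element u) + □ (⊖ (element v ⊖ element u)) + χ (element v ⊖ element u ≈? 0#)
        ≡⟨ trichotomy (element v ⊖ element u) ⟩
      1 ∎
      where open ≡-Reasoning

    G₂-irreflexive : ∀ u → ¬ Digraph.Edge (G₂ F) u u
    G₂-irreflexive u (u⊖u≉0 , _) = u⊖u≉0 (⊖-inverseʳ (element u))

    G₂-asymmetric : Asymmetric (Digraph.Edge (G₂ F))
    G₂-asymmetric {u} {v} uv vu = not-both uv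
      (square-cong (≈-sym (⊖[x⊖y]≈y⊖x (element v) (element u))) vu)

    □-idem : ∀ x → □ x * □ x ≡ □ x
    □-idem x = χ-idem (isNonzeroSquare? x)

    -- For a nonzero square x, the successors of x among the nonzero squares are the
    -- y such that y and y - x are nonzero squares, and there are M of these.
    chains-in-squares : chains arc 2 (□ ∘ element) ≡ S * M
    chains-in-squares = begin
      ∑[ u < q ] (□ (element u) * ∑[ v < q ] (□ (element v) * arc u v * 1))
        ≡⟨ sum-cong-≗ (λ u → trans
             (cong (□ (element u) *_) (sum-cong-≗ λ v → ℕ.*-identityʳ (□ (element v) * arc u v)))
             (successors (element u) (isNonzeroSquare? (element u)))) ⟩
      ∑[ u < q ] (□ (element u) * M)
        ≡⟨ *-distribʳ-sum M (□ ∘ element) ⟨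
      S * M ∎
      where
      open ≡-Reasoning
      successors : ∀ x (d : Dec (IsNonzeroSquare x)) →
        χ d * ∑F (λ y → □ y * □ (y ⊖ x)) ≡ χ d * M
      successors x (yes x□) = cong (1 *_) (shifted-squares x□)
      successors x (no _)   = refl

    -- Equating the two counts of the arcs spanned by the nonzero squares and
    -- dividing by S gives 2M + 1 = S.
    M≡j : M ≡ j
    M≡j = cancel S j M S≡1+2j (begin
      S * M + S * M + S
        ≡⟨ cong (λ k → k + k + S) chains-in-squares ⟨
      chains arc 2 (□ ∘ element) + chains arc 2 (□ ∘ element) + S
        ≡⟨ chains₂-tournament arc arc-tournament (□ ∘ element) (□-idem ∘ element) ⟩
      S * S ∎)
      where
      open ≡-Reasoning
      cancel : ∀ s j m → s ≡ suc (2 * j) → s * m + s * m + s ≡ s * s → m ≡ j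
      cancel s j m refl eq = ℕ.*-cancelˡ-≡ m j 2 (ℕ.suc-injective
        (ℕ.*-cancelˡ-≡ (suc (2 * m)) s s (trans (factor s m) eq)))
        where
        factor : ∀ s m → s * suc (2 * m) ≡ s * m + s * m + s
        factor = solve-∀

    out-degree : ∀ u → ∑[ v < q ] arc u v ≡ S
    out-degree u = sym (∑F-translate □-ext (⊖ element u))

    -- Summing over the arcs u → v the identity 2T + M = M², where T counts the arcs
    -- spanned by the M common successors of u and v.
    chains-4 : chains arc 4 (λ _ → 1) + chains arc 4 (λ _ → 1) + q * S * M ≡ q * S * (M * M)
    chains-4 = begin
      K + K + q * S * M
        ≡⟨ cong₂ (λ k l → k + k + l) K≡ (sym (arcs M)) ⟩
      ∑∑ T + ∑∑ T + ∑∑ (λ u v → arc u v * M)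
        ≡⟨ trans (∑∑-+ (λ u v → T u v + T u v) (λ u v → arc u v * M))
                 (cong (_+ ∑∑ (λ u v → arc u v * M)) (∑∑-+ T T)) ⟨
      ∑∑ (λ u v → T u v + T u v + arc u v * M)
        ≡⟨ (sum-cong-≗ λ u → sum-cong-≗ (per-arc u)) ⟩
      ∑∑ (λ u v → arc u v * (M * M))
        ≡⟨ arcs (M * M) ⟩
      q * S * (M * M) ∎
      where
      open ≡-Reasoning
      K = chains arc 4 (λ _ → 1)
      -- N u v is the indicator of the common successors of u and v; T u v counts the
      -- arcs between them, and vanishes unless u → v.
      N : Fin q → Fin q → Fin q → ℕ
      N u v w = arc u w * arc v w
      T : Fin q → Fin q → ℕ
      T u v = arc u v * chains arc 2 (N u v)
      arcs : ∀ k → ∑∑ (λ u v → arc u v * k) ≡ q * S * k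
      arcs k = begin
        ∑∑ (λ u v → arc u v * k)
          ≡⟨ sum-cong-≗ (λ u → trans (sym (*-distribʳ-sum k (arc u))) (cong (_* k) (out-degree u))) ⟩
        ∑[ u < q ] (S * k)   ≡⟨ ∑-const q (S * k) ⟩
        q * (S * k)          ≡⟨ ℕ.*-assoc q S k ⟨
        q * S * k            ∎
      K≡ : K ≡ ∑∑ T
      K≡ = sum-cong-≗ λ u → trans (ℕ.*-identityˡ _) (sum-cong-≗ λ v →
        cong₂ _*_ (ℕ.*-identityˡ (arc u v))
          (chains-cong arc 2 λ w → cong (_* arc v w) (ℕ.*-identityˡ (arc u w))))
      per-arc : ∀ u v → T u v + T u v + arc u v * M ≡ arc u v * (M * M)
      per-arc u v = trans (factor (arc u v) (chains arc 2 (N u v)) M)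
        (aux (isNonzeroSquare? (element v ⊖ element u)))
        where
        factor : ∀ a c m → a * c + a * c + a * m ≡ a * (c + c + m)
        factor = solve-∀
        N-idem : ∀ w → N u v w * N u v w ≡ N u v w
        N-idem w = trans (regroup (arc u w) (arc v w)) (cong₂ _*_ (□-idem _) (□-idem _))
          where
          regroup : ∀ x y → x * y * (x * y) ≡ (x * x) * (y * y)
          regroup = solve-∀
        aux : (d : Dec (IsNonzeroSquare (element v ⊖ element u))) →
          χ d * (chains arc 2 (N u v) + chains arc 2 (N u v) + M) ≡ χ d * (M * M)
        aux (no _)   = refl
        aux (yes uv) = cong (1 *_) (subst
          (λ m → chains arc 2 (N u v) + chains arc 2 (N u v) + m ≡ m * m)
          (common-successors (element u) (element v) uv)
          (chains₂-tournament arc arc-tournament (N u v) N-idem))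

    𝒦₄ : 𝒦 4 (G₂ F) + 𝒦 4 (G₂ F) + q * suc (2 * j) * j ≡ q * suc (2 * j) * (j * j)
    𝒦₄ = subst₂ (λ s m → 𝒦 4 (G₂ F) + 𝒦 4 (G₂ F) + q * s * m ≡ q * s * (m * m)) S≡1+2j M≡j
      (subst (λ k → k + k + q * S * M ≡ q * S * (M * M))
             (sym (𝒦≡chains (G₂ F) G₂-irreflexive G₂-asymmetric 4)) chains-4)

-- The closed formula over the integers

module ClosedFormula where

  open import Data.Integer.Base using (+_; _+_; _-_; _*_)

  -- The identity 64 K = q (q - 1) (q - 3) (q - 7) for q = 4j + 3, obtained from
  -- the subtraction-free equation for 2K on multiplying by 32.
  integer-form : ∀ K q j → q ≡ 3 ℕ.+ j ℕ.* 4 →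
    K ℕ.+ K ℕ.+ q ℕ.* suc (2 ℕ.* j) ℕ.* j ≡ q ℕ.* suc (2 ℕ.* j) ℕ.* (j ℕ.* j) →
    + K * + 64 ≡ + q * (+ q - + 1) * (+ q - + 3) * (+ q - + 7)
  integer-form K q j refl eq = begin
    + K * + 64
      ≡⟨ complete (+ K) (X (+ q)) ⟩
    (+ K + + K + X (+ q)) * + 32 - X (+ q) * + 32
      ≡⟨ cong (λ s → s * + 32 - X (+ q) * + 32) eqℤ ⟩
    Y (+ q) * + 32 - X (+ q) * + 32
      ≡⟨ cong (λ q → Y q * + 32 - X q * + 32) qℤ ⟩
    Y (+ 3 + + j * + 4) * + 32 - X (+ 3 + + j * + 4) * + 32
      ≡⟨ factor (+ j) ⟩
    _ ≡⟨ cong (λ q → q * (q - + 1) * (q - + 3) * (q - + 7)) qℤ ⟨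
    + q * (+ q - + 1) * (+ q - + 3) * (+ q - + 7) ∎
    where
    open ≡-Reasoning
    X Y : ℤ.ℤ → ℤ.ℤ
    X q = q * (+ 1 + + 2 * + j) * + j
    Y q = q * (+ 1 + + 2 * + j) * (+ j * + j)
    qℤ : + q ≡ + 3 + + j * + 4
    qℤ = cong (λ t → + 3 + t) (ℤ.pos-* j 4)
    cast : ∀ k → + (q ℕ.* suc (2 ℕ.* j) ℕ.* k) ≡ + q * (+ 1 + + 2 * + j) * + k
    cast k = trans (ℤ.pos-* (q ℕ.* suc (2 ℕ.* j)) k) (cong (λ t → t * + k)
      (trans (ℤ.pos-* q (suc (2 ℕ.* j))) (cong (λ t → + q * (+ 1 + t)) (ℤ.pos-* 2 j))))
    eqℤ : + K + + K + X (+ q) ≡ Y (+ q)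
    eqℤ = begin
      + (K ℕ.+ K) + X (+ q)                             ≡⟨ cong (λ t → + (K ℕ.+ K) + t) (cast j) ⟨
      + (K ℕ.+ K ℕ.+ q ℕ.* suc (2 ℕ.* j) ℕ.* j)         ≡⟨ cong +_ eq ⟩
      + (q ℕ.* suc (2 ℕ.* j) ℕ.* (j ℕ.* j))             ≡⟨ cast (j ℕ.* j) ⟩
      + q * (+ 1 + + 2 * + j) * + (j ℕ.* j)
        ≡⟨ cong (λ t → + q * (+ 1 + + 2 * + j) * t) (ℤ.pos-* j j) ⟩
      Y (+ q) ∎
    complete : ∀ k x → k * + 64 ≡ (k + k + x) * + 32 - x * + 32
    complete = ℤ.solve-∀
    factor : ∀ j →
      (+ 3 + j * + 4) * (+ 1 + + 2 * j) * (j * j) * + 32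
        - (+ 3 + j * + 4) * (+ 1 + + 2 * j) * j * + 32 ≡
      (+ 3 + j * + 4) * (+ 3 + j * + 4 - + 1) * (+ 3 + j * + 4 - + 3) * (+ 3 + j * + 4 - + 7)
    factor = ℤ.solve-∀

  -- Equality of fractions from the cross-multiplied equation.
  /1≡/64 : ∀ k x → k * + 64 ≡ x → k / 1 ≡ x / 64
  /1≡/64 k x eq = fromℚᵘ-cong {mkℚᵘ k 0} {mkℚᵘ x 63} (*≡* (trans eq (sym (ℤ.*-identityʳ x))))

open ClosedFormula

open import Data.Integer.Base using (+_; _*_; _-_)

corollary2p3 : ∀ {c ℓ : Level} (q : ℕ) → IsPrimePower q → q % 4 ≡ 3 →
    (F : FiniteField c ℓ q) →
    (+ 𝒦 4 (G₂ F)) / 1 ≡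
    (+ q * (+ q - + 1) * (+ q - + 3) * (+ q - + 7)) / (2 ^ 6)
corollary2p3 q _ q%4≡3 F = /1≡/64 (+ 𝒦 4 (G₂ F)) _
  (integer-form (𝒦 4 (G₂ F)) q j q≡3+4j 𝒦₄)
  where
  j = q ℕ./ 4
  q≡3+4j : q ≡ 3 ℕ.+ j ℕ.* 4
  q≡3+4j = trans (m≡m%n+[m/n]*n q 4) (cong (ℕ._+ j ℕ.* 4) q%4≡3)
  open Paley.Order≡3mod4 F j q≡3+4j
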